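{- Let $r>s\ge 0$ and $i\ge 0$ be integers. There exists a bijection from the set of set partitions of $[r+s]$ of shape $(r,s)$ with interlacing number $i$ onto the set of standard Young tableaux of shape $(r+i,s-i)$.
   Context: The shape of a set partition is its list of block sizes in weakly decreasing order. Let $\mathbb{N}^*=\mathbb{N}\cup\{\infty\}$ with $\infty$ larger than all integers. Arcs $(a,b)$ and $(c,d)$ cross if $a<c<b<d$ or $c<a<d<b$. For a set $A=\{a_1<\dots<a_l\}$, its $j$-th arc is $(a_j,a_{j+1})$ for $j<l$ and $(a_l,\infty)$ for $j=l$. For a set partition with blocks $A_1,\dots,A_m$ (listed in increasing order of least elements), an interlacing is a pair consisting of the $j$-th arcs of $A_i$ and $A_{i'}$ that cross, for some $i<i'$ and $1\le j\le\min(|A_i|,|A_{i'}|)$; the interlacing number is the number of interlacings. A standard Young tableau of shape $(a,b)$ is a filling of the two-row Young diagram by $1,\dots,a+b$ with increasing rows and columns (empty set of such if $b<0$). -}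

module Defs where

open import Data.Bool using (Bool; true; false; _∧_; _∨_; if_then_else_)
open import Data.Nat using (ℕ; zero; suc; _+_; _<ᵇ_)
open import Data.Fin using (Fin; toℕ)
import Data.Fin as F
open import Data.Fin.Subset using (Subset; _∈_; ∣_∣; Nonempty)
open import Data.List using (List; []; _∷_; _++_; map; zip)
open import Data.Nat.ListAction using (sum)
open import Data.List.Relation.Unary.All using (All)
open import Data.List.Relation.Unary.Any using (Any)
open import Data.List.Relation.Unary.AllPairs using (AllPairs)
open import Data.List.Relation.Unary.Unique.Propositional using (Unique)
open import Data.List.Relation.Binary.Permutation.Propositional using (_↭_)
open import Data.List.Membership.Propositional using () renaming (_∈_ to _∈ₗ_)
open import Data.Vec using (Vec; lookup; toList) renaming (_++_ to _++ᵥ_)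
open import Data.Product using (_×_; _,_; ∃; Σ)
open import Data.Empty using (⊥)
open import Data.Sum using (_⊎_)
open import Data.Integer using (ℤ; +_; -[1+_])
open import Relation.Nullary using (¬_)
open import Relation.Nullary.Decidable using (does)
open import Relation.Binary.PropositionalEquality using (_≡_)

-- Set partitions of [n].  The ground set [n] = {1,…,n} is modelled by
-- Fin n (element k+1 ↦ k); only the order of elements matters below.

Disjoint : ∀ {n} → Subset n → Subset n → Set
Disjoint A B = ∀ x → ¬ (x ∈ A × x ∈ B)

LeastBefore : ∀ {n} → Subset n → Subset n → Set
LeastBefore A B = ∃ λ y → y ∈ A × (∀ x → x ∈ B → y F.< x)

-- A set partition of [n], blocks listed in increasing order of least
-- elements (this makes the representation canonical).
record SetPartition (n : ℕ) : Set where
  field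
    blocks    : List (Subset n)
    .nonempty : All Nonempty blocks
    .disjoint : AllPairs Disjoint blocks
    .covering : ∀ (x : Fin n) → Any (x ∈_) blocks
    .ordered  : AllPairs LeastBefore blocks
open SetPartition public

twoRowShape : ℕ → ℕ → List ℕ
twoRowShape r zero    = r ∷ []
twoRowShape r (suc s) = r ∷ suc s ∷ []

-- shape of P (sorted list of block sizes) equals the partition (r,s)
-- (given r ≥ s, the block sizes sorted decreasingly equal (r,s) iff the
-- list of block sizes is a permutation of (r,s)).
HasShape : ∀ {n} → SetPartition n → ℕ → ℕ → Set
HasShape P r s = map ∣_∣ (blocks P) ↭ twoRowShape r s

data ℕ* : Set where
  fin : ℕ → ℕ*
  ∞   : ℕ*

_<*_ : ℕ* → ℕ* → Bool
fin m <* fin k = m <ᵇ k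
fin _ <* ∞     = true
∞     <* _     = false

Arc : Set
Arc = ℕ* × ℕ*

crosses : Arc → Arc → Bool
crosses (a , b) (c , d) =
  (a <* c ∧ c <* b ∧ b <* d) ∨ (c <* a ∧ a <* d ∧ d <* b)

elements : ∀ {n} → Subset n → List ℕ
elements {n} A = map toℕ (Data.List.filterᵇ (λ x → lookup A x) (Data.List.allFin n))

arcs : List ℕ → List Arc
arcs []            = []
arcs (x ∷ [])      = (fin x , ∞) ∷ []
arcs (x ∷ y ∷ xs)  = (fin x , fin y) ∷ arcs (y ∷ xs)

count : List Bool → ℕ
count []          = 0
count (true ∷ bs)  = suc (count bs)
count (false ∷ bs) = count bs

interlacingsOf : ∀ {n} → Subset n → Subset n → ℕ
interlacingsOf A B =
  count (map (λ p → crosses (Data.Product.proj₁ p) (Data.Product.proj₂ p))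
             (zip (arcs (elements A)) (arcs (elements B))))

orderedPairs : ∀ {a} {X : Set a} → List X → List (X × X)
orderedPairs []       = []
orderedPairs (x ∷ xs) = map (x ,_) xs ++ orderedPairs xs

interlacingNumber : ∀ {n} → SetPartition n → ℕ
interlacingNumber P =
  sum (map (λ p → interlacingsOf (Data.Product.proj₁ p) (Data.Product.proj₂ p))
           (orderedPairs (blocks P)))

record PartitionsOf (r s i : ℕ) : Set where
  field
    partition : SetPartition (r + s)
    .shape    : HasShape partition r s
    .interl   : interlacingNumber partition ≡ i
open PartitionsOf public

-- Standard Young tableaux of two-row shape (a,b).  Entries 1,…,a+b are
-- modelled by Fin (a+b) (value k+1 ↦ k).  top = first row (length a),
-- bot = second row (length b), columns j aligned by position.

record Tableau (a b : ℕ) : Set where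
  field
    top : Vec (Fin (a + b)) a
    bot : Vec (Fin (a + b)) b
    .shapeOK   : b Data.Nat.≤ a
    .topIncr   : ∀ (j k : Fin a) → j F.< k → lookup top j F.< lookup top k
    .botIncr   : ∀ (j k : Fin b) → j F.< k → lookup bot j F.< lookup bot k
    .colIncr   : ∀ (j : Fin a) (k : Fin b) → toℕ j ≡ toℕ k →
                 lookup top j F.< lookup bot k
    .distinct  : Unique (toList (top ++ᵥ bot))
    .allUsed   : ∀ (x : Fin (a + b)) → x ∈ₗ toList (top ++ᵥ bot)
open Tableau public

SYT : ℕ → ℤ → Set
SYT a (+ b)     = Tableau a b
SYT a -[1+ _ ]  = ⊥

{-# OPTIONS --safe #-}

-- Read the big block of a partition of shape (r,s) as a lattice word (element
-- in the big block = up, otherwise down), a path from 0 to height d = r − s > 0.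
-- The j-th arcs of the two blocks cross exactly when the path returns to the
-- axis at the larger of the two j-th elements and bounces back to the side it
-- came from.  Normalise each excursion to lie above the axis, and turn its
-- closing down-step into an up-step when it is followed by a bounce: the result
-- is a ballot path ending at d + 2i, with i the number of bounces, i.e. a
-- tableau of shape (r+i,s−i).  Read from the right this is a Mealy machine whose
-- output function is an involution in every state, hence invertible.

module Submission where

open import Defs
open import Data.Bool using (Bool; true; false; not; _∧_; _xor_; if_then_else_)
import Data.Bool.Properties as Bool
open import Data.Empty using (⊥-elim)
open import Data.Fin as Fin using (Fin; toℕ)
import Data.Fin.Properties as Fin
open import Data.Fin.Subset using (Subset; ∣_∣; ∁; _∈_; Nonempty)
open import Data.Fin.Subset.Properties
  using (_∈?_; ⊆-antisym; x∈p⇒x∉∁p; x∈∁p⇒x∉p; x∉p⇒x∈∁p; ∣p∣≤∣x∷p∣)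
open import Data.Integer using (+_; _-_)
import Data.Integer.Properties as ℤ
open import Data.List as List using (List; []; _∷_; length; zip)
import Data.List.Properties as List
import Data.List.Membership.DecPropositional as DecMembership
open import Data.List.Membership.Propositional using () renaming (_∈_ to _∈ₗ_)
open import Data.List.Membership.Propositional.Properties using (∈-map⁺; ∈-map⁻; ∈-++⁺ˡ; ∈-++⁺ʳ; ∈-++⁻)
open import Data.List.Relation.Binary.Permutation.Propositional using (_↭_; swap; ↭-refl; ↭-trans)
open import Data.List.Relation.Binary.Permutation.Propositional.Properties
  using (↭-length; ↭-singleton-inv; ∈-resp-↭; drop-∷)
open import Data.List.Relation.Unary.All as All using (All; []; _∷_)
import Data.List.Relation.Unary.All.Properties as All
open import Data.List.Relation.Unary.AllPairs as AllPairs using (AllPairs; []; _∷_)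
open import Data.List.Relation.Unary.Any using (Any; here; there)
open import Data.List.Relation.Unary.Unique.Propositional using (Unique)
import Data.List.Relation.Unary.Unique.Propositional.Properties as Unique
open import Data.Nat using (ℕ; zero; suc; _+_; _*_; _∸_; _<_; _≤_; _≟_; _<?_; _≤?_; z≤n; s≤s; s<s; z<s)
open import Data.Nat.ListAction using (sum)
open import Data.Nat.Properties hiding (_≟_; _≤?_; _<?_)
open import Data.Nat.Solver using (module +-*-Solver)
open import Data.Product using (_×_; _,_; ∃; proj₁; proj₂)
open import Data.Sum using (_⊎_; inj₁; inj₂; [_,_]′)
open import Data.Vec as Vec using (Vec; []; _∷_; here; there; lookup; toList; tabulate; cast)
open import Data.Vec.Properties
  using (≡-dec; lookup-map; lookup∘tabulate; lookup⇒[]=; []=⇒lookup; cast-is-id;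
         toList-map; toList-++; toList-cast; toList-injective; length-toList)
open import Function using (_∘_; id; _↔_; mk↔ₛ′; Inverse)
open import Function.Bundles using (_⤖_)
open import Function.Construct.Composition using (_↔-∘_)
open import Function.Properties.Inverse using (↔⇒⤖)
open import Relation.Binary.Definitions using (tri<; tri≈; tri>)
open import Relation.Binary.PropositionalEquality
open import Relation.Nullary using (¬_; Dec; does; yes; no; contradiction; recompute)
open import Relation.Nullary.Decidable using (dec-true; dec-false)

-- The bounce machine, its inverse, and the ballot paths it outputs.

private variable
  n m d i r s a b h : ℕ

-- State of the machine after reading a suffix: the prefix before it ends at
-- height +height or −height according to sign.  At height 0, sign is the side
-- on which the suffix starts.
record State : Set where
  constructor state
  field
    sign           : Bool
    height bounces : ℕ
open State

-- The letter `x` is undone, going back along the path. At height 0 it ended an excursion on the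
-- side `not x`, so there is a bounce exactly when the suffix also starts on that side.
step : Bool → State → State
step x (state σ zero    k) = state (not x) 1 (if x xor σ then suc k else k)
step x (state σ (suc h) k) = if x xor σ then state σ (2 + h) k else state σ h k

run : ℕ → Vec Bool n → State
run d []      = state true d 0
run d (x ∷ v) = step x (run d v)

-- `x xor σ` says that the letter points against the side `σ`. If the step ends off the axis, this
-- is a normalised down-step; if it ends on the axis, it is a bounce, output as an up-step.
encode : State → Bool → Bool
encode (state σ zero    _) x = x xor σ
encode (state σ (suc _) _) x = not (x xor σ)

encode-involutive : ∀ s x → encode s (encode s x) ≡ x
encode-involutive (state true  zero    _) true  = refl
encode-involutive (state true  zero    _) false = refl
encode-involutive (state false zero    _) true  = refl
encode-involutive (state false zero    _) false = refl
encode-involutive (state true  (suc _) _) true  = refl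
encode-involutive (state true  (suc _) _) false = refl
encode-involutive (state false (suc _) _) true  = refl
encode-involutive (state false (suc _) _) false = refl

transduce : ℕ → Vec Bool n → Vec Bool n
transduce d []      = []
transduce d (x ∷ v) = encode (run d v) x ∷ transduce d v

-- The state governing a letter depends only on the input suffix, which is already recovered when
-- that letter is decoded.
untransduce : ℕ → Vec Bool n → Vec Bool n
untransduce d []      = []
untransduce d (y ∷ u) = encode (run d (untransduce d u)) y ∷ untransduce d u

transduce∘untransduce : ∀ d (u : Vec Bool n) → transduce d (untransduce d u) ≡ u
transduce∘untransduce d []      = refl
transduce∘untransduce d (y ∷ u) =
  cong₂ _∷_ (encode-involutive (run d (untransduce d u)) y) (transduce∘untransduce d u)

untransduce∘transduce : ∀ d (v : Vec Bool n) → untransduce d (transduce d v) ≡ v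
untransduce∘transduce d []      = refl
untransduce∘transduce d (x ∷ v) rewrite untransduce∘transduce d v =
  cong (_∷ v) (encode-involutive (run d v) x)

-- A path from height h to height m that never goes below 0.
data Ballot (m : ℕ) : ∀ {n} → ℕ → Vec Bool n → Set where
  []   : Ballot m m []
  up   : ∀ {h} {v : Vec Bool n} → Ballot m (suc h) v → Ballot m h (true ∷ v)
  down : ∀ {h} {v : Vec Bool n} → Ballot m h v → Ballot m (suc h) (false ∷ v)

-- If j bounces lie in the prefix still to be read, each of them makes the output
-- drop by 2 relative to the normalised input, reading from the right.
Reaches : ℕ → State → Vec Bool n → Set
Reaches d s u = ∀ j → Ballot (d + (bounces s + j) * 2) (height s + j * 2) u

reaches-step : ∀ d x s {u : Vec Bool n} → Reaches d s u → Reaches d (step x s) (encode s x ∷ u)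
reaches-step d true  (state true  zero    k) b j = down (b j)
reaches-step d false (state false zero    k) b j = down (b j)
reaches-step d true  (state true  (suc h) k) b j = up (b j)
reaches-step d false (state false (suc h) k) b j = up (b j)
reaches-step d true  (state false (suc h) k) b j = down (b j)
reaches-step d false (state true  (suc h) k) b j = down (b j)
-- A bounce: seen from the suffix it was still unread, so the hypothesis is used at `suc j`. The
-- output rises from `1 + j * 2` to `suc j * 2` where the normalised path falls to the axis.
reaches-step d true  (state false zero    k) {u} b j =
  up (subst (λ l → Ballot (d + l * 2) (suc j * 2) u) (+-suc k j) (b (suc j)))
reaches-step d false (state true  zero    k) {u} b j =
  up (subst (λ l → Ballot (d + l * 2) (suc j * 2) u) (+-suc k j) (b (suc j)))

transduce-reaches : ∀ d (v : Vec Bool n) → Reaches d (run d v) (transduce d v)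
transduce-reaches d []      j = []
transduce-reaches d (x ∷ v)   = reaches-step d x (run d v) (transduce-reaches d v)

-- The converse of `Reaches`, needed for the inverse map: a ballot output ending at `m` can start
-- only at a height explained by some number `j` of unread bounces.
ReachedBy : ℕ → ℕ → State → Vec Bool n → Set
ReachedBy m i s u = ∀ {h} → Ballot m h u → ∃ λ j → h ≡ height s + j * 2 × i ≡ bounces s + j

reachedBy-step : ∀ m i x s {u : Vec Bool n} →
                 ReachedBy m i s u → ReachedBy m i (step x s) (encode s x ∷ u)
reachedBy-step m i true  (state true  zero    k) r (down b) with j , refl , q ← r b = j , refl , q
reachedBy-step m i false (state false zero    k) r (down b) with j , refl , q ← r b = j , refl , q
reachedBy-step m i true  (state false (suc h) k) r (down b) with j , refl , q ← r b = j , refl , q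
reachedBy-step m i false (state true  (suc h) k) r (down b) with j , refl , q ← r b = j , refl , q
reachedBy-step m i true  (state true  (suc h) k) r (up b) with j , refl , q ← r b = j , refl , q
reachedBy-step m i false (state false (suc h) k) r (up b) with j , refl , q ← r b = j , refl , q
-- The state has height 0, so the positive height after the up-step comes from unread bounces alone;
-- the present letter is one of them.
reachedBy-step m i true  (state false zero    k) r (up b) with suc j , refl , q ← r b =
  j , refl , trans q (+-suc k j)
reachedBy-step m i false (state true  zero    k) r (up b) with suc j , refl , q ← r b =
  j , refl , trans q (+-suc k j)

transduce-reachedBy : ∀ d i (v : Vec Bool n) → ReachedBy (d + i * 2) i (run d v) (transduce d v)
-- Before the empty suffix all `i` bounces are unread.
transduce-reachedBy d i []      [] = i , refl , refl
transduce-reachedBy d i (x ∷ v)    = reachedBy-step (d + i * 2) i x (run d v) (transduce-reachedBy d i v)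

-- Path heights and letter counts.

Balanced : ℕ → State → ℕ → ℕ → Set
Balanced d (state true  h _) u c = c + d ≡ h + u
Balanced d (state false h _) u c = h + (c + d) ≡ u

balanced-step : ∀ d x s (v : Subset n) →
                Balanced d s ∣ v ∣ ∣ ∁ v ∣ → Balanced d (step x s) ∣ x ∷ v ∣ ∣ ∁ (x ∷ v) ∣
balanced-step d true  (state true  zero    k) v b = cong suc b
balanced-step d true  (state false zero    k) v b = cong suc b
balanced-step d false (state true  zero    k) v b = cong suc b
balanced-step d false (state false zero    k) v b = cong suc b
balanced-step d true  (state true  (suc h) k) v b = trans b (sym (+-suc h ∣ v ∣))
balanced-step d true  (state false (suc h) k) v b = cong suc b
balanced-step d false (state true  (suc h) k) v b = cong suc b
balanced-step d false (state false (suc h) k) v b = trans (+-suc h _) b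

-- The signed height of the prefix, plus the up-steps minus the down-steps of the suffix, is the end
-- height `d`; `Balanced` expresses this without subtraction.
run-balanced : ∀ d (v : Subset n) → Balanced d (run d v) ∣ v ∣ ∣ ∁ v ∣
run-balanced d []      = sym (+-identityʳ d)
run-balanced d (x ∷ v) = balanced-step d x (run d v) v (run-balanced d v)

height≡0⇒∣v∣ : ∀ d (v : Subset n) → height (run d v) ≡ 0 → ∣ v ∣ ≡ ∣ ∁ v ∣ + d
height≡0⇒∣v∣ d v eq with run d v | run-balanced d v
height≡0⇒∣v∣ d v refl | state true  _ _ | b = sym b
height≡0⇒∣v∣ d v refl | state false _ _ | b = sym b

∣v∣⇒height≡0 : ∀ d (v : Subset n) → ∣ v ∣ ≡ ∣ ∁ v ∣ + d → height (run d v) ≡ 0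
∣v∣⇒height≡0 d v eq with run d v | run-balanced d v
... | state true  h _ | b = +-cancelʳ-≡ _ h 0 (trans (sym b) (sym eq))
... | state false h _ | b = +-cancelʳ-≡ _ h 0 (trans b eq)

-- Interlacings as bounces

positions : ℕ → Subset n → List ℕ
positions o []          = []
positions o (true  ∷ v) = o ∷ positions (suc o) v
positions o (false ∷ v) = positions (suc o) v

side : Bool → Subset n → Subset n
side true  v = v
side false v = ∁ v

interlacings : List ℕ → List ℕ → ℕ
interlacings xs ys = count (List.map (λ p → crosses (proj₁ p) (proj₂ p)) (zip (arcs xs) (arcs ys)))

crosses-sym : ∀ p q → crosses p q ≡ crosses q p
crosses-sym (a , b) (c , d) = Bool.∨-comm (a <* c ∧ c <* b ∧ b <* d) _

interlacings-sym : ∀ xs ys → interlacings xs ys ≡ interlacings ys xs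
interlacings-sym xs ys = cong count (go (arcs xs) (arcs ys))
  where
  go : ∀ ps qs → List.map (λ p → crosses (proj₁ p) (proj₂ p)) (zip ps qs) ≡
                 List.map (λ p → crosses (proj₁ p) (proj₂ p)) (zip qs ps)
  go []       []       = refl
  go []       (_ ∷ _)  = refl
  go (_ ∷ _)  []       = refl
  go (p ∷ ps) (q ∷ qs) = cong₂ _∷_ (crosses-sym p q) (go ps qs)

next : List ℕ → ℕ*
next []      = ∞
next (x ∷ _) = fin x

arcs-∷ : ∀ x xs → arcs (x ∷ xs) ≡ (fin x , next xs) ∷ arcs xs
arcs-∷ x []      = refl
arcs-∷ x (_ ∷ _) = refl

-- Once the left ends are ordered, only one of the two crossing patterns remains possible.
interlacings-∷ : ∀ {a b} xs ys → a < b → interlacings (a ∷ xs) (b ∷ ys) ≡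
  (if fin b <* next xs ∧ next xs <* next ys then suc (interlacings xs ys) else interlacings xs ys)
interlacings-∷ {a} {b} xs ys a<b
  rewrite arcs-∷ a xs | arcs-∷ b ys | dec-true (a <? b) a<b | dec-false (b <? a) (<-asym a<b)
  with fin b <* next xs ∧ next xs <* next ys
... | true  = refl
... | false = refl

next-later : ∀ {p o} (v : Subset n) → p < o →
  (fin p <* next (positions o v)) ≡ true × (next (positions o v) <* fin p) ≡ false
next-later []          p<o = refl , refl
next-later {p = p} {o} (true ∷ v)  p<o =
  dec-true (p <? o) p<o , dec-false (o <? p) (<-asym p<o)
next-later (false ∷ v) p<o = next-later v (m<n⇒m<1+n p<o)

-- Height 0 arises only by undoing a step that leaves the axis, and such a step leads to the side of
-- its letter.
height≡0⇒starts : ∀ d x (v : Subset n) → height (run (suc d) (x ∷ v)) ≡ 0 → sign (run (suc d) (x ∷ v)) ≡ x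
height≡0⇒starts d true  v eq with run (suc d) v
height≡0⇒starts d true  v ()   | state σ     zero    _
height≡0⇒starts d true  v eq   | state true  (suc _) _ = refl
height≡0⇒starts d true  v ()   | state false (suc _) _
height≡0⇒starts d false v eq with run (suc d) v
height≡0⇒starts d false v ()   | state σ     zero    _
height≡0⇒starts d false v ()   | state true  (suc _) _
height≡0⇒starts d false v eq   | state false (suc _) _ = refl

Starts : Bool → Subset n → Set
Starts σ v = ∀ o → next (positions o (side σ v)) ≡ fin o ×
                   ∃ λ m → ∃ λ (v′ : Subset m) → positions o (side (not σ) v) ≡ positions (suc o) v′

-- The empty suffix cannot occur, since the path ends at `suc d`, off the axis.
starts : ∀ d (v : Subset n) → height (run (suc d) v) ≡ 0 → Starts (sign (run (suc d) v)) v
starts d (x ∷ v) eq o rewrite height≡0⇒starts d x v eq with x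
... | true  = refl , _ , ∁ v , refl
... | false = refl , _ , v , refl

-- The elements pending in a prefix ending at height ±h are the last h ones of
-- the side that is ahead; the others have already been paired off.
Interlaces : State → Subset n → Set
Interlaces (state σ h k) v = ∀ o pending → All (_< o) pending → length pending ≡ h →
  interlacings (pending List.++ positions o (side σ v)) (positions o (side (not σ) v)) ≡ k

interlacings-[]ʳ : ∀ xs → interlacings xs [] ≡ 0
interlacings-[]ʳ xs = interlacings-sym xs []

All<-suc : ∀ {o xs} → All (_< o) xs → All (_< suc o) xs
All<-suc = All.map m<n⇒m<1+n

-- The element `o` joins the side that is ahead: it becomes pending, and no pair of arcs is settled
-- yet.
rise : ∀ {h} o pending xs ys k → All (_< o) pending → length pending ≡ h →
  (∀ p → All (_< suc o) p → length p ≡ suc h → interlacings (p List.++ xs) ys ≡ k) →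
  interlacings (pending List.++ o ∷ xs) ys ≡ k
rise o pending xs ys k lt len ih = trans
  (cong (λ l → interlacings l ys) (sym (List.++-assoc pending (o ∷ []) xs)))
  (ih (pending List.++ o ∷ []) (All.++⁺ (All<-suc lt) (n<1+n o ∷ []))
    (trans (List.length-++ pending) (trans (+-comm _ 1) (cong suc len))))

-- The element `o` is paired with the first pending `a`, whose arc ends at the next pending `b`. As
-- `b < o`, the two arcs are disjoint.
fall : ∀ {h} o pending xs ys k → All (_< o) pending → length pending ≡ 2 + h →
  (∀ p → All (_< suc o) p → length p ≡ suc h → interlacings (p List.++ xs) ys ≡ k) →
  interlacings (pending List.++ xs) (o ∷ ys) ≡ k
fall o (a ∷ b ∷ pending) xs ys k (a<o ∷ b<o ∷ lt) len ih
  rewrite interlacings-∷ (b ∷ pending List.++ xs) ys a<o | dec-false (o <? b) (<-asym b<o) =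
  ih (b ∷ pending) (All<-suc (b<o ∷ lt)) (suc-injective len)

-- The suffix starts on the side of `a`, so the arc from `a` ends at `suc o`, strictly between `o`
-- and the end of the arc from `o`.
bounce : ∀ o pending σ (v : Subset n) k → All (_< o) pending → length pending ≡ 1 → Starts σ v →
  interlacings (positions (suc o) (side σ v)) (positions (suc o) (side (not σ) v)) ≡ k →
  interlacings (pending List.++ positions (suc o) (side σ v)) (o ∷ positions (suc o) (side (not σ) v)) ≡ suc k
bounce o (a ∷ []) σ v k (a<o ∷ []) len st ih with st (suc o)
... | e , m , v′ , f
  rewrite interlacings-∷ (positions (suc o) (side σ v)) (positions (suc o) (side (not σ) v)) a<o
        | e | f | dec-true (o <? suc o) (n<1+n o) | proj₁ (next-later v′ (n<1+n (suc o))) = cong suc ih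

-- Here the path crosses the axis and the arcs do not cross: the suffix starts on the side of `o`,
-- so the arc from `o` ends at `suc o` and is nested in the arc from `a`.
crossing : ∀ o pending σ (v : Subset n) k → All (_< o) pending → length pending ≡ 1 → Starts σ v →
  interlacings (positions (suc o) (side σ v)) (positions (suc o) (side (not σ) v)) ≡ k →
  interlacings (pending List.++ positions (suc o) (side (not σ) v)) (o ∷ positions (suc o) (side σ v)) ≡ k
crossing o (a ∷ []) σ v k (a<o ∷ []) len st ih with st (suc o)
... | e , m , v′ , f
  rewrite interlacings-∷ (positions (suc o) (side (not σ) v)) (positions (suc o) (side σ v)) a<o
        | e | f | proj₂ (next-later v′ (n<1+n (suc o)))
        | proj₁ (next-later v′ (m<n⇒m<1+n (n<1+n o))) =
  -- The pending element lay on the side opposite to `σ`, so the hypothesis has the lists exchanged.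
  trans (interlacings-sym (positions (2 + o) v′) _) ih

interlaces-step : ∀ x s (v : Subset n) → (height s ≡ 0 → Starts (sign s) v) →
                  Interlaces s v → Interlaces (step x s) (x ∷ v)
interlaces-step true  (state true  zero    k) v st ih o p lt len =
  crossing o p true v k lt len (st refl) (ih (suc o) [] [] refl)
interlaces-step true  (state false zero    k) v st ih o p lt len =
  bounce o p false v k lt len (st refl) (ih (suc o) [] [] refl)
interlaces-step false (state true  zero    k) v st ih o p lt len =
  bounce o p true v k lt len (st refl) (ih (suc o) [] [] refl)
interlaces-step false (state false zero    k) v st ih o p lt len =
  crossing o p false v k lt len (st refl) (ih (suc o) [] [] refl)
interlaces-step true  (state true  (suc h) k) v st ih o p lt len = rise o p _ _ k lt len (ih (suc o))
interlaces-step true  (state false (suc h) k) v st ih o p lt len = fall o p _ _ k lt len (ih (suc o))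
interlaces-step false (state true  (suc h) k) v st ih o p lt len = fall o p _ _ k lt len (ih (suc o))
interlaces-step false (state false (suc h) k) v st ih o p lt len = rise o p _ _ k lt len (ih (suc o))

run-interlaces : ∀ d (v : Subset n) → Interlaces (run (suc d) v) v
run-interlaces d []      o p lt len = interlacings-[]ʳ (p List.++ [])
run-interlaces d (x ∷ v)            =
  interlaces-step x (run (suc d) v) v (starts d v) (run-interlaces d v)

-- The general `g` and `o` serve the induction: each tail of `allFin` tabulates a shifted function.
filter-tabulate : ∀ o (v : Subset n) {A : Set} (g : Fin n → A) (p : A → Bool) (h : A → ℕ) →
  (∀ i → p (g i) ≡ lookup v i) → (∀ i → h (g i) ≡ o + toℕ i) →
  List.map h (List.filterᵇ p (List.tabulate g)) ≡ positions o v
filter-tabulate o [] g p h pg hg = refl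
filter-tabulate o (x ∷ v) g p h pg hg
  with ih ← filter-tabulate (suc o) v (g ∘ Fin.suc) p h (pg ∘ Fin.suc)
              (λ i → trans (hg (Fin.suc i)) (+-suc o (toℕ i)))
  rewrite pg Fin.zero with x
... | true  = cong₂ _∷_ (trans (hg Fin.zero) (+-identityʳ o)) ih
... | false = ih

elements≡positions : (v : Subset n) → elements v ≡ positions 0 v
elements≡positions v = filter-tabulate 0 v id (lookup v) toℕ (λ _ → refl) (λ _ → refl)

interlacingsOf-sym : (A B : Subset n) → interlacingsOf A B ≡ interlacingsOf B A
interlacingsOf-sym A B = interlacings-sym (elements A) (elements B)

interlacingsOf≡bounces : ∀ d (v : Subset n) → height (run (suc d) v) ≡ 0 →
  interlacingsOf v (∁ v) ≡ bounces (run (suc d) v)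
interlacingsOf≡bounces d v eq
  with run (suc d) v | run-interlaces d v
interlacingsOf≡bounces d v refl | state true  _ k | il =
  trans (cong₂ interlacings (elements≡positions v) (elements≡positions (∁ v))) (il 0 [] [] refl)
interlacingsOf≡bounces d v refl | state false _ k | il = trans (interlacingsOf-sym v (∁ v))
  (trans (cong₂ interlacings (elements≡positions (∁ v)) (elements≡positions v)) (il 0 [] [] refl))

-- Ballot words and tableaux

Increasing : Vec (Fin n) a → Set
Increasing t = ∀ j k → j Fin.< k → lookup t j Fin.< lookup t k

-- Column condition for the part of a tableau in a suffix: its first h bottom
-- entries lie below top entries of the prefix.
Aligned : ℕ → Vec (Fin n) a → Vec (Fin n) b → Set
Aligned h t u = ∀ j k → toℕ k ≡ h + toℕ j → lookup t j Fin.< lookup u k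

places : (v : Subset n) → Vec (Fin n) ∣ v ∣
places []          = []
places (true  ∷ v) = Fin.zero ∷ Vec.map Fin.suc (places v)
places (false ∷ v) = Vec.map Fin.suc (places v)

lookup-suc : (t : Vec (Fin n) a) → ∀ j → lookup (Vec.map Fin.suc t) j ≡ Fin.suc (lookup t j)
lookup-suc t j = lookup-map j Fin.suc t

map-suc-< : ∀ (t : Vec (Fin n) a) (u : Vec (Fin n) b) {j k} → lookup t j Fin.< lookup u k →
            lookup (Vec.map Fin.suc t) j Fin.< lookup (Vec.map Fin.suc u) k
map-suc-< t u {j} {k} p rewrite lookup-suc t j | lookup-suc u k = s<s p

map-suc-<⁻ : ∀ (t : Vec (Fin n) a) (u : Vec (Fin n) b) {j k} →
             lookup (Vec.map Fin.suc t) j Fin.< lookup (Vec.map Fin.suc u) k → lookup t j Fin.< lookup u k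
map-suc-<⁻ t u {j} {k} p rewrite lookup-suc t j | lookup-suc u k = ≤-pred p

zero<map-suc : ∀ (t : Vec (Fin n) a) k → Fin.zero {n} Fin.< lookup (Vec.map Fin.suc t) k
zero<map-suc t k rewrite lookup-suc t k = z<s

places-increasing : (v : Subset n) → Increasing (places v)
places-increasing (true  ∷ v) Fin.zero    (Fin.suc k) _   = zero<map-suc (places v) k
places-increasing (true  ∷ v) (Fin.suc j) (Fin.suc k) j<k =
  map-suc-< (places v) (places v) (places-increasing v j k (≤-pred j<k))
places-increasing (false ∷ v) j           k           j<k =
  map-suc-< (places v) (places v) (places-increasing v j k j<k)

∈-places⁺ : ∀ {x} {v : Subset n} → x ∈ v → x ∈ₗ toList (places v)
∈-places⁺ here = here refl
∈-places⁺ {v = true  ∷ v} (there x∈v) rewrite toList-map Fin.suc (places v) = there (∈-map⁺ Fin.suc (∈-places⁺ x∈v))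
∈-places⁺ {v = false ∷ v} (there x∈v) rewrite toList-map Fin.suc (places v) = ∈-map⁺ Fin.suc (∈-places⁺ x∈v)

∈-places⁻ : ∀ {x} (v : Subset n) → x ∈ₗ toList (places v) → x ∈ v
∈-places⁻ (true ∷ v) (here refl) = here
∈-places⁻ (true ∷ v) (there x∈) rewrite toList-map Fin.suc (places v)
  with _ , y∈ , refl ← ∈-map⁻ Fin.suc x∈ = there (∈-places⁻ v y∈)
∈-places⁻ (false ∷ v) x∈ rewrite toList-map Fin.suc (places v)
  with _ , y∈ , refl ← ∈-map⁻ Fin.suc x∈ = there (∈-places⁻ v y∈)

-- An up-step supplies a top entry smaller than all later places. A down-step sits under a top entry
-- of the prefix, so its own place imposes no condition within the suffix.
ballot⇒aligned : (v : Subset n) → Ballot m h v → Aligned h (places v) (places (∁ v))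
ballot⇒aligned         (true  ∷ v) (up b)   Fin.zero    k           eq = zero<map-suc (places (∁ v)) k
ballot⇒aligned {h = h} (true  ∷ v) (up b)   (Fin.suc j) k           eq =
  map-suc-< (places v) (places (∁ v)) (ballot⇒aligned v b j k (trans eq (+-suc h (toℕ j))))
ballot⇒aligned         (false ∷ v) (down b) j           (Fin.suc k) eq =
  map-suc-< (places v) (places (∁ v)) (ballot⇒aligned v b j k (suc-injective eq))

aligned⇒ballot : ∀ m h (v : Subset n) → Aligned h (places v) (places (∁ v)) →
                 h + ∣ v ∣ ≡ m + ∣ ∁ v ∣ → Ballot m h v
aligned⇒ballot m h [] al eq
  with refl ← trans (sym (+-identityʳ h)) (trans eq (+-identityʳ m)) = []
aligned⇒ballot m h (true ∷ v) al eq = up (aligned⇒ballot m (suc h) v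
  (λ j k e → map-suc-<⁻ (places v) (places (∁ v)) (al (Fin.suc j) k (trans e (sym (+-suc h (toℕ j))))))
  (trans (sym (+-suc h ∣ v ∣)) eq))
aligned⇒ballot m (suc h) (false ∷ v) al eq = down (aligned⇒ballot m h v
  (λ j k e → map-suc-<⁻ (places v) (places (∁ v)) (al j (Fin.suc k) (cong suc e)))
  (suc-injective (trans eq (+-suc m ∣ ∁ v ∣))))
-- A down-step on the axis: the counts force an up-step further on, and alignment would put its
-- place before place 0.
aligned⇒ballot m zero (false ∷ v) al eq with ∣ v ∣ | places v | trans eq (+-suc m ∣ ∁ v ∣)
... | suc _ | t | _ with () ← al Fin.zero Fin.zero refl

ballot-count : (v : Subset n) → Ballot m h v → h + ∣ v ∣ ≡ m + ∣ ∁ v ∣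
ballot-count         []          []       = refl
ballot-count {h = h} (true  ∷ v) (up b)   = trans (+-suc h ∣ v ∣) (ballot-count v b)
ballot-count {m = m} (false ∷ v) (down b) = trans (cong suc (ballot-count v b)) (sym (+-suc m _))

∣v∣+∣∁v∣≡n : (v : Subset n) → ∣ v ∣ + ∣ ∁ v ∣ ≡ n
∣v∣+∣∁v∣≡n []          = refl
∣v∣+∣∁v∣≡n (true  ∷ v) = cong suc (∣v∣+∣∁v∣≡n v)
∣v∣+∣∁v∣≡n (false ∷ v) = trans (+-suc ∣ v ∣ _) (cong suc (∣v∣+∣∁v∣≡n v))

sum-difference-unique : ∀ {a b c d} e → a ≡ e + b → c ≡ e + d → a + b ≡ c + d → a ≡ c × b ≡ d
sum-difference-unique {b = b} {d = d} e refl refl eq = cong (_+_ e) b≡d , b≡d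
  where
  double : ∀ x → e + x + x ≡ e + x * 2
  double x = trans (+-assoc e x x) (cong (_+_ e)
    (trans (cong (_+_ x) (sym (+-identityʳ x))) (*-comm 2 x)))
  b≡d : b ≡ d
  b≡d = *-cancelʳ-≡ b d 2 (+-cancelˡ-≡ e _ _ (trans (sym (double b)) (trans eq (double d))))

lookup⇒All : ∀ {P : Fin n → Set} (t : Vec (Fin n) a) → (∀ k → P (lookup t k)) → All P (toList t)
lookup⇒All []      p = []
lookup⇒All (x ∷ t) p = p Fin.zero ∷ lookup⇒All t (p ∘ Fin.suc)

Sorted : List (Fin n) → Set
Sorted = AllPairs Fin._<_

increasing⇒sorted : (t : Vec (Fin n) a) → Increasing t → Sorted (toList t)
increasing⇒sorted []      inc = []
increasing⇒sorted (x ∷ t) inc =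
  lookup⇒All t (λ k → inc Fin.zero (Fin.suc k) z<s) ∷
  increasing⇒sorted t (λ j k j<k → inc (Fin.suc j) (Fin.suc k) (s<s j<k))

-- Equal sets have equal minima, so the heads agree; strictness keeps the common head out of both
-- tails.
sorted-extensional : {xs ys : List (Fin n)} → Sorted xs → Sorted ys →
  (∀ {z} → z ∈ₗ xs → z ∈ₗ ys) → (∀ {z} → z ∈ₗ ys → z ∈ₗ xs) → xs ≡ ys
sorted-extensional {xs = []}     {[]}     _ _ _ _ = refl
sorted-extensional {xs = []}     {y ∷ ys} _ _ _ g with () ← g (here refl)
sorted-extensional {xs = x ∷ xs} {[]}     _ _ f _ with () ← f (here refl)
sorted-extensional {xs = x ∷ xs} {y ∷ ys} (x< ∷ sx) (y< ∷ sy) f g with Fin.<-cmp x y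
... | tri< x<y _ _ = contradiction (f (here refl)) λ where
  (here refl)  → Fin.<-irrefl refl x<y
  (there x∈ys) → Fin.<-asym x<y (All.lookup y< x∈ys)
... | tri> _ _ y<x = contradiction (g (here refl)) λ where
  (here refl)  → Fin.<-irrefl refl y<x
  (there y∈xs) → Fin.<-asym y<x (All.lookup x< y∈xs)
... | tri≈ _ refl _ = cong (x ∷_) (sorted-extensional sx sy (tail x< f) (tail y< g))
  where
  tail : ∀ {us vs} → All (x Fin.<_) us → (∀ {z} → z ∈ₗ x ∷ us → z ∈ₗ x ∷ vs) → ∀ {z} → z ∈ₗ us → z ∈ₗ vs
  tail x<us f z∈us with f (there z∈us)
  ... | here refl  = contradiction (All.lookup x<us z∈us) (Fin.<-irrefl refl)
  ... | there z∈vs = z∈vs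

_∈ₗ?_ : (x : Fin n) (xs : List (Fin n)) → Dec (x ∈ₗ xs)
_∈ₗ?_ = DecMembership._∈?_ Fin._≟_

members : Vec (Fin n) a → Subset n
members t = tabulate (λ x → does (x ∈ₗ? toList t))

∈-members⁺ : ∀ {x} (t : Vec (Fin n) a) → x ∈ₗ toList t → x ∈ members t
∈-members⁺ {x = x} t x∈t =
  lookup⇒[]= x (members t) (trans (lookup∘tabulate _ x) (dec-true (x ∈ₗ? toList t) x∈t))

∈-members⁻ : ∀ {x} (t : Vec (Fin n) a) → x ∈ members t → x ∈ₗ toList t
∈-members⁻ {x = x} t x∈m with x ∈ₗ? toList t | trans (sym (lookup∘tabulate _ x)) ([]=⇒lookup x∈m)
... | yes x∈t | _ = x∈t
... | no _    | ()

members∘places : ∀ (v : Subset n) .(eq : ∣ v ∣ ≡ a) → members (cast eq (places v)) ≡ v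
members∘places v eq = ⊆-antisym
  (λ x∈ → ∈-places⁻ v (subst (_ ∈ₗ_) (toList-cast eq (places v)) (∈-members⁻ _ x∈)))
  (λ x∈ → ∈-members⁺ _ (subst (_ ∈ₗ_) (sym (toList-cast eq (places v))) (∈-places⁺ x∈)))

-- The entry bound `n` is detached from the row lengths, so that the conditions of a tableau can be
-- transported along `cast`.
record IsTableau {n a b} (t : Vec (Fin n) a) (u : Vec (Fin n) b) : Set where
  constructor isTableau
  field
    top-increasing : Increasing t
    bot-increasing : Increasing u
    aligned        : ∀ j k → toℕ j ≡ toℕ k → lookup t j Fin.< lookup u k
    unique         : Unique (toList (t Vec.++ u))
    exhaustive     : ∀ x → x ∈ₗ toList (t Vec.++ u)

places-isTableau : (v : Subset n) → Ballot m 0 v → IsTableau (places v) (places (∁ v))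
places-isTableau v b = isTableau (places-increasing v) (places-increasing (∁ v))
  (λ j k eq → ballot⇒aligned v b j k (sym eq))
  (subst Unique (sym (toList-++ (places v) _)) (Unique.++⁺ (places-unique v) (places-unique (∁ v))
    λ (x∈v , x∈∁v) → x∈p⇒x∉∁p (∈-places⁻ v x∈v) (∈-places⁻ (∁ v) x∈∁v)))
  (λ x → subst (x ∈ₗ_) (sym (toList-++ (places v) _)) (covered x))
  where
  places-unique : ∀ w → Unique (toList (places w))
  places-unique w = AllPairs.map (λ p eq → Fin.<-irrefl eq p) (increasing⇒sorted _ (places-increasing w))
  covered : ∀ x → x ∈ₗ toList (places v) List.++ toList (places (∁ v))
  covered x with x ∈? v
  ... | yes x∈v = ∈-++⁺ˡ (∈-places⁺ x∈v)
  ... | no  x∉v = ∈-++⁺ʳ (toList (places v)) (∈-places⁺ (x∉p⇒x∈∁p x∉v))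

cast-isTableau : ∀ {n a b a′ b′} {t : Vec (Fin n) a} {u : Vec (Fin n) b} (eq : a ≡ a′) (eq′ : b ≡ b′) →
                 IsTableau t u → IsTableau (cast eq t) (cast eq′ u)
cast-isTableau {t = t} {u} refl refl T = subst₂ IsTableau (sym (cast-is-id refl t)) (sym (cast-is-id refl u)) T

uncast-isTableau : ∀ {n a b a′ b′} {t : Vec (Fin n) a} {u : Vec (Fin n) b} (eq : a ≡ a′) (eq′ : b ≡ b′) →
                   IsTableau (cast eq t) (cast eq′ u) → IsTableau t u
uncast-isTableau {t = t} {u} refl refl T = subst₂ IsTableau (cast-is-id refl t) (cast-is-id refl u) T

unique-++-disjoint : ∀ {A : Set} (xs : List A) {ys x} → Unique (xs List.++ ys) → x ∈ₗ xs → ¬ x ∈ₗ ys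
unique-++-disjoint (x ∷ xs) (x≢ ∷ _) (here refl)  x∈ys = All.lookup (All.++⁻ʳ xs x≢) x∈ys refl
unique-++-disjoint (x ∷ xs) (_ ∷ un) (there x∈xs) x∈ys = unique-++-disjoint xs un x∈xs x∈ys

toList-length : ∀ {A : Set} (t : Vec A a) (u : Vec A b) → toList t ≡ toList u → a ≡ b
toList-length t u eq = trans (sym (length-toList t)) (trans (cong length eq) (length-toList u))

module _ {t : Vec (Fin n) a} {u : Vec (Fin n) b} (T : IsTableau t u) where
  open IsTableau T

  private
    disjoint′ : ∀ {x} → x ∈ₗ toList t → ¬ x ∈ₗ toList u
    disjoint′ = unique-++-disjoint (toList t) (subst Unique (toList-++ t u) unique)

  -- Stated for lists because the length indices of the two vectors are not yet known to agree;
  -- `∣members∣` is deduced from it.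
  toList-places-top : toList (places (members t)) ≡ toList t
  toList-places-top = sorted-extensional
    (increasing⇒sorted _ (places-increasing (members t))) (increasing⇒sorted t top-increasing)
    (∈-members⁻ t ∘ ∈-places⁻ _) (∈-places⁺ ∘ ∈-members⁺ t)

  toList-places-bot : toList (places (∁ (members t))) ≡ toList u
  toList-places-bot = sorted-extensional
    (increasing⇒sorted _ (places-increasing (∁ (members t)))) (increasing⇒sorted u bot-increasing)
    (λ z∈ → into (∈-places⁻ (∁ (members t)) z∈))
    (λ z∈u → ∈-places⁺ (x∉p⇒x∈∁p λ z∈m → disjoint′ (∈-members⁻ t z∈m) z∈u))
    where
    into : ∀ {z} → z ∈ ∁ (members t) → z ∈ₗ toList u
    into {z} z∈ with ∈-++⁻ (toList t) (subst (z ∈ₗ_) (toList-++ t u) (exhaustive z))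
    ... | inj₁ z∈t = contradiction (∈-members⁺ t z∈t) (x∈∁p⇒x∉p z∈)
    ... | inj₂ z∈u = z∈u

  ∣members∣ : ∣ members t ∣ ≡ a
  ∣members∣ = toList-length _ t toList-places-top

  ∣∁members∣ : ∣ ∁ (members t) ∣ ≡ b
  ∣∁members∣ = toList-length _ u toList-places-bot

  members-ballot : a ≡ m + b → Ballot m 0 (members t)
  members-ballot a≡m+b = aligned⇒ballot _ 0 (members t)
    (λ j k eq → IsTableau.aligned uncast j k (sym eq))
    (trans ∣members∣ (trans a≡m+b (cong (_+_ _) (sym ∣∁members∣))))
    where
    uncast : IsTableau (places (members t)) (places (∁ (members t)))
    uncast = uncast-isTableau ∣members∣ ∣∁members∣ (subst₂ IsTableau
      (sym (toList-injective ∣members∣ _ t toList-places-top))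
      (sym (toList-injective ∣∁members∣ _ u toList-places-bot)) T)

record BallotWord (n m : ℕ) : Set where
  constructor ballotWord
  field
    word    : Subset n
    .ballot : Ballot m 0 word

BallotWord-≡ : {u v : BallotWord n m} → BallotWord.word u ≡ BallotWord.word v → u ≡ v
BallotWord-≡ {u = ballotWord _ _} {ballotWord _ _} refl = refl

ballot-counts : a ≡ m + b → (v : Subset (a + b)) → Ballot m 0 v → ∣ v ∣ ≡ a × ∣ ∁ v ∣ ≡ b
ballot-counts {m = m} eq v bal = sum-difference-unique m (ballot-count v bal) eq (∣v∣+∣∁v∣≡n v)

Tableau-≡ : {T U : Tableau a b} → top T ≡ top U → bot T ≡ bot U → T ≡ U
Tableau-≡ {T = record {}} {record {}} refl refl = refl

word-isTableau : ∀ (eq : a ≡ m + b) (v : Subset (a + b)) (bal : Ballot m 0 v) →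
  IsTableau (cast (proj₁ (ballot-counts eq v bal)) (places v)) (cast (proj₂ (ballot-counts eq v bal)) (places (∁ v)))
word-isTableau eq v bal with ∣v∣≡a , ∣∁v∣≡b ← ballot-counts eq v bal =
  cast-isTableau ∣v∣≡a ∣∁v∣≡b (places-isTableau v bal)

tableau : a ≡ m + b → BallotWord (a + b) m → Tableau a b
tableau {a} {m} {b} eq (ballotWord v bal) = record
  -- `cast` takes its equation irrelevantly, so the irrelevant `bal` may supply it.
  { top      = cast (proj₁ (ballot-counts eq v bal)) (places v)
  ; bot      = cast (proj₂ (ballot-counts eq v bal)) (places (∁ v))
  ; shapeOK  = subst (b ≤_) (sym eq) (m≤n+m b m)
  ; topIncr  = IsTableau.top-increasing (word-isTableau eq v bal)
  ; botIncr  = IsTableau.bot-increasing (word-isTableau eq v bal)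
  ; colIncr  = IsTableau.aligned (word-isTableau eq v bal)
  ; distinct = IsTableau.unique (word-isTableau eq v bal)
  ; allUsed  = IsTableau.exhaustive (word-isTableau eq v bal)
  }

readingWord : a ≡ m + b → Tableau a b → BallotWord (a + b) m
readingWord eq record { top = t ; bot = u ; topIncr = ti ; botIncr = bi ; colIncr = ci ; distinct = di ; allUsed = al } =
  ballotWord (members t) (members-ballot (isTableau {u = u} ti bi ci di al) eq)

tableau∘readingWord : ∀ (eq : a ≡ m + b) (T : Tableau a b) → tableau eq (readingWord eq T) ≡ T
tableau∘readingWord eq
  record { top = t ; bot = u ; topIncr = ti ; botIncr = bi ; colIncr = ci ; distinct = di ; allUsed = al } =
  Tableau-≡
    -- The tableau conditions are irrelevant; decidability of vector equality makes the equation
    -- usable.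
    (recompute (≡-dec Fin._≟_ _ _) (toList-injective _ _ t (toList-places-top (isTableau {u = u} ti bi ci di al))))
    (recompute (≡-dec Fin._≟_ _ _) (toList-injective _ _ u (toList-places-bot (isTableau {t = t} ti bi ci di al))))

ballotWords↔tableaux : a ≡ m + b → BallotWord (a + b) m ↔ Tableau a b
ballotWords↔tableaux {a} eq = mk↔ₛ′ (tableau eq) (readingWord eq) (tableau∘readingWord eq)
  (λ (ballotWord v bal) → BallotWord-≡ (members∘places {a = a} v _))

-- Words with a given number of bounces correspond to ballot words.

record BouncingWord (n d i : ℕ) : Set where
  constructor bouncingWord
  field
    word     : Subset n
    .closed  : height (run d word) ≡ 0
    .bounced : bounces (run d word) ≡ i

BouncingWord-≡ : {u v : BouncingWord n d i} → BouncingWord.word u ≡ BouncingWord.word v → u ≡ v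
BouncingWord-≡ {u = bouncingWord _ _ _} {bouncingWord _ _ _} refl = refl

-- No prefix precedes the whole word, so no bounce is unread and `Reaches` is used at 0.
transduce-ballot : ∀ d (v : Subset n) → height (run d v) ≡ 0 → bounces (run d v) ≡ i →
                   Ballot (d + i * 2) 0 (transduce d v)
transduce-ballot d v h≡0 k≡i = subst₂ (λ k h → Ballot (d + k * 2) h (transduce d v))
  (trans (+-identityʳ _) k≡i) (trans (+-identityʳ _) h≡0) (transduce-reaches d v 0)

-- The ballot path starts at 0, and `height s + j * 2` vanishes only if both terms do.
ballot⇒closed : ∀ d (v : Subset n) → Ballot (d + i * 2) 0 (transduce d v) →
                height (run d v) ≡ 0 × bounces (run d v) ≡ i
ballot⇒closed {i = i} d v b with transduce-reachedBy d i v b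
... | zero  , h≡0 , k≡i = trans (sym (+-identityʳ _)) (sym h≡0) , trans (sym (+-identityʳ _)) (sym k≡i)
... | suc j , e   , _   = contradiction (trans e (+-suc (height (run d v)) _)) λ ()

untransduce-closed : ∀ d (u : Subset n) → Ballot (d + i * 2) 0 u →
                     height (run d (untransduce d u)) ≡ 0 × bounces (run d (untransduce d u)) ≡ i
untransduce-closed {i = i} d u b =
  ballot⇒closed {i = i} d (untransduce d u) (subst (Ballot _ 0) (sym (transduce∘untransduce d u)) b)

bouncingWords↔ballotWords : BouncingWord n d i ↔ BallotWord n (d + i * 2)
bouncingWords↔ballotWords {d = d} {i} = mk↔ₛ′
  (λ (bouncingWord v c b) → ballotWord (transduce d v) (transduce-ballot d v c b))
  (λ (ballotWord u b) → bouncingWord (untransduce d u)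
    (proj₁ (untransduce-closed {i = i} d u b)) (proj₂ (untransduce-closed {i = i} d u b)))
  (λ (ballotWord u b) → BallotWord-≡ (transduce∘untransduce d u))
  (λ (bouncingWord v c b) → BouncingWord-≡ (untransduce∘transduce d v))

-- Partitions as words of the big block

-- The order by least elements puts the block containing place 0 first. The clause for the empty
-- word is a filler.
twoBlocks : Subset n → List (Subset n)
twoBlocks []          = [] ∷ [] ∷ []
twoBlocks (true  ∷ v) = (true ∷ v) ∷ ∁ (true ∷ v) ∷ []
twoBlocks (false ∷ v) = ∁ (false ∷ v) ∷ (false ∷ v) ∷ []

blocksOf : ℕ → Subset n → List (Subset n)
blocksOf zero    v = v ∷ []
blocksOf (suc _) v = twoBlocks v

-- The value on the empty list is junk: a partition has one or two blocks here.
bigBlock : ℕ → List (Subset n) → Subset n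
bigBlock r []          = Data.Fin.Subset.⊥
bigBlock r (A ∷ [])    = A
bigBlock r (A ∷ B ∷ _) with ∣ A ∣ ≟ r
... | yes _ = A
... | no  _ = B

record IsPartition (bs : List (Subset n)) (r s : ℕ) : Set where
  constructor isPartition
  field
    nonempty : All Nonempty bs
    disjoint : AllPairs Disjoint bs
    covering : ∀ (x : Fin n) → Any (x ∈_) bs
    ordered  : AllPairs LeastBefore bs
    shape    : List.map ∣_∣ bs ↭ twoRowShape r s

∁-involutive : (v : Subset n) → ∁ (∁ v) ≡ v
∁-involutive []      = refl
∁-involutive (x ∷ v) = cong₂ _∷_ (Bool.not-involutive x) (∁-involutive v)

0<∣v∣⇒nonempty : (v : Subset n) → 0 < ∣ v ∣ → Nonempty v
0<∣v∣⇒nonempty (true  ∷ v) _ = Fin.zero , here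
0<∣v∣⇒nonempty (false ∷ v) p with x , x∈v ← 0<∣v∣⇒nonempty v p = Fin.suc x , there x∈v

∈⇒0<∣v∣ : ∀ {x} {v : Subset n} → x ∈ v → 0 < ∣ v ∣
∈⇒0<∣v∣                here        = z<s
∈⇒0<∣v∣ {v = x ∷ v} (there x∈v) = ≤-trans (∈⇒0<∣v∣ x∈v) (∣p∣≤∣x∷p∣ x v)

covers : (v : Subset n) → ∀ x → x ∈ v ⊎ x ∈ ∁ v
covers v x with x ∈? v
... | yes x∈v = inj₁ x∈v
... | no  x∉v = inj₂ (x∉p⇒x∈∁p x∉v)

zero-leastBefore : (v w : Subset n) → LeastBefore (true ∷ v) (false ∷ w)
zero-leastBefore v w = Fin.zero , here , λ { (Fin.suc x) _ → z<s }

twoBlocks-isPartition : ∀ (v : Subset n) → ∣ v ∣ ≡ suc r → ∣ ∁ v ∣ ≡ suc s →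
                        IsPartition (twoBlocks v) (suc r) (suc s)
twoBlocks-isPartition {r = r} {s} (true ∷ v) p q = isPartition
  ((Fin.zero , here) ∷ 0<∣v∣⇒nonempty (false ∷ ∁ v) (subst (0 <_) (sym q) z<s) ∷ [])
  (((λ _ (x∈ , x∈∁) → x∈p⇒x∉∁p x∈ x∈∁) ∷ []) ∷ [] ∷ [])
  (λ x → [ here , (λ x∈∁ → there (here x∈∁)) ]′ (covers (true ∷ v) x))
  ((zero-leastBefore v (∁ v) ∷ []) ∷ [] ∷ [])
  (subst₂ (λ a b → a ∷ b ∷ [] ↭ suc r ∷ suc s ∷ []) (sym p) (sym q) ↭-refl)
twoBlocks-isPartition {r = r} {s} (false ∷ v) p q = isPartition
  ((Fin.zero , here) ∷ 0<∣v∣⇒nonempty (false ∷ v) (subst (0 <_) (sym p) z<s) ∷ [])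
  (((λ _ (x∈∁ , x∈) → x∈p⇒x∉∁p x∈ x∈∁) ∷ []) ∷ [] ∷ [])
  (λ x → [ (λ x∈ → there (here x∈)) , here ]′ (covers (false ∷ v) x))
  ((zero-leastBefore (∁ v) v ∷ []) ∷ [] ∷ [])
  (subst₂ (λ a b → a ∷ b ∷ [] ↭ suc r ∷ suc s ∷ []) (sym q) (sym p) (swap _ _ ↭-refl))

blocksOf-isPartition : ∀ s (v : Subset n) → 0 < r → ∣ v ∣ ≡ r → ∣ ∁ v ∣ ≡ s → IsPartition (blocksOf s v) r s
blocksOf-isPartition {r = suc r} (suc s) v _ p q = twoBlocks-isPartition v p q
blocksOf-isPartition zero v 0<r p q = isPartition
  (0<∣v∣⇒nonempty v (subst (0 <_) (sym p) 0<r) ∷ [])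
  ([] ∷ [])
  (λ x → here ([ id , (λ x∈∁ → contradiction (∈⇒0<∣v∣ x∈∁) (<-irrefl (sym q))) ]′ (covers v x)))
  ([] ∷ [])
  (subst (λ a → a ∷ [] ↭ _ ∷ []) (sym p) ↭-refl)

-- As `s < r`, the size test on the first block cannot mistake the small block for the big one.
bigBlock-blocksOf : ∀ s (v : Subset n) → s < r → ∣ v ∣ ≡ r → ∣ ∁ v ∣ ≡ s → bigBlock r (blocksOf s v) ≡ v
bigBlock-blocksOf zero _ _ _ _ = refl
bigBlock-blocksOf (suc s) (true ∷ v) _ refl _ with ∣ true ∷ v ∣ ≟ ∣ true ∷ v ∣
... | yes _  = refl
... | no  ≢r = contradiction refl ≢r
bigBlock-blocksOf {r = r} (suc s) (false ∷ v) s<r p q with ∣ ∁ (false ∷ v) ∣ ≟ r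
... | yes e = contradiction (trans (sym q) e) (<⇒≢ s<r)
... | no  _ = refl

complements : {A B : Subset n} → Disjoint A B → (∀ x → Any (x ∈_) (A ∷ B ∷ [])) → B ≡ ∁ A
complements {A = A} {B} dis cov = ⊆-antisym
  (λ x∈B → x∉p⇒x∈∁p λ x∈A → dis _ (x∈A , x∈B))
  (λ {x} x∈∁A → inB (x∈∁p⇒x∉p x∈∁A) (cov x))
  where
  inB : ∀ {x} → ¬ x ∈ A → Any (x ∈_) (A ∷ B ∷ []) → x ∈ B
  inB x∉A (here x∈A)         = contradiction x∈A x∉A
  inB x∉A (there (here x∈B)) = x∈B

pair-↭ : ∀ {a b c d : ℕ} → a ∷ b ∷ [] ↭ c ∷ d ∷ [] → (a ≡ c × b ≡ d) ⊎ (a ≡ d × b ≡ c)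
pair-↭ {a} {b} {c} {d} p with ∈-resp-↭ p (here refl)
... | here refl = inj₁ (refl , List.∷-injectiveˡ (↭-singleton-inv (drop-∷ p)))
... | there (here refl) =
  inj₂ (refl , List.∷-injectiveˡ (↭-singleton-inv (drop-∷ (↭-trans p (swap c d ↭-refl)))))

-- `A` must contain place 0: otherwise the complement does, and nothing lies below it.
twoBlocks-first : (A : Subset n) → LeastBefore A (∁ A) → twoBlocks A ≡ A ∷ ∁ A ∷ []
twoBlocks-first (true  ∷ A) _             = refl
twoBlocks-first (false ∷ A) (y , _ , y<∁A) with () ← y<∁A Fin.zero here

twoBlocks-second : (A : Subset n) → LeastBefore A (∁ A) → twoBlocks (∁ A) ≡ A ∷ ∁ A ∷ []
twoBlocks-second (true  ∷ A) _             = cong (λ B → (true ∷ B) ∷ (false ∷ ∁ A) ∷ []) (∁-involutive A)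
twoBlocks-second (false ∷ A) (y , _ , y<∁A) with () ← y<∁A Fin.zero here

-- The length of the shape fixes the number of blocks. If there are two, the second is the
-- complement of the first, and the order by least elements determines the listing.
partition-bigBlock : ∀ s (bs : List (Subset n)) → IsPartition bs r s →
                     blocksOf s (bigBlock r bs) ≡ bs × ∣ bigBlock r bs ∣ ≡ r
partition-bigBlock zero [] P with () ← ↭-length (IsPartition.shape P)
partition-bigBlock zero (A ∷ []) P = refl , List.∷-injectiveˡ (↭-singleton-inv (IsPartition.shape P))
partition-bigBlock zero (A ∷ B ∷ bs) P with () ← ↭-length (IsPartition.shape P)
partition-bigBlock (suc s) [] P with () ← ↭-length (IsPartition.shape P)
partition-bigBlock (suc s) (A ∷ []) P with () ← ↭-length (IsPartition.shape P)
partition-bigBlock (suc s) (A ∷ B ∷ C ∷ bs) P with () ← ↭-length (IsPartition.shape P)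
partition-bigBlock {r = r} (suc s) (A ∷ B ∷ [])
  (isPartition _ ((dis ∷ []) ∷ _) cov ((before ∷ []) ∷ _) sh)
  with refl ← complements dis cov with ∣ A ∣ ≟ r | pair-↭ sh
... | yes p | _            = twoBlocks-first A before , p
... | no ¬p | inj₁ (p , _) = contradiction p ¬p
... | no _  | inj₂ (_ , q) = twoBlocks-second A before , q

totalInterlacings : List (Subset n) → ℕ
totalInterlacings bs = sum (List.map (λ p → interlacingsOf (proj₁ p) (proj₂ p)) (orderedPairs bs))

positions-empty : ∀ o (v : Subset n) → ∣ v ∣ ≡ 0 → positions o v ≡ []
positions-empty o []          _ = refl
positions-empty o (false ∷ v) e = positions-empty (suc o) v e

-- A single block forms no pair, and correspondingly an empty complement has no arcs. With two
-- blocks, symmetry absorbs their order.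
totalInterlacings-blocksOf : ∀ s (v : Subset n) → ∣ ∁ v ∣ ≡ s →
                             totalInterlacings (blocksOf s v) ≡ interlacingsOf v (∁ v)
totalInterlacings-blocksOf zero v e = sym (trans
  (cong (interlacings (elements v)) (trans (elements≡positions (∁ v)) (positions-empty 0 (∁ v) e)))
  (interlacings-[]ʳ (elements v)))
totalInterlacings-blocksOf (suc s) (true  ∷ v) e = +-identityʳ _
totalInterlacings-blocksOf (suc s) (false ∷ v) e =
  trans (+-identityʳ _) (interlacingsOf-sym (∁ (false ∷ v)) (false ∷ v))

PartitionsOf-≡ : {P Q : PartitionsOf r s i} → blocks (partition P) ≡ blocks (partition Q) → P ≡ Q
PartitionsOf-≡ {P = record { partition = record {} }} {record { partition = record {} }} refl = refl

-- The bijection of partitions with bouncing words.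

module _ {r s d : ℕ} (r≡d+s : r ≡ suc d + s) where

  closed-counts : (v : Subset (r + s)) → height (run (suc d) v) ≡ 0 → ∣ v ∣ ≡ r × ∣ ∁ v ∣ ≡ s
  closed-counts v h≡0 = sum-difference-unique (suc d)
    (trans (height≡0⇒∣v∣ (suc d) v h≡0) (+-comm _ (suc d))) r≡d+s (∣v∣+∣∁v∣≡n v)

  ∣v∣≡r⇒∣∁v∣≡s : (v : Subset (r + s)) → ∣ v ∣ ≡ r → ∣ ∁ v ∣ ≡ s
  ∣v∣≡r⇒∣∁v∣≡s v e = +-cancelˡ-≡ r _ _ (trans (cong (_+ ∣ ∁ v ∣) (sym e)) (∣v∣+∣∁v∣≡n v))

  ∣v∣≡r⇒closed : (v : Subset (r + s)) → ∣ v ∣ ≡ r → height (run (suc d) v) ≡ 0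
  ∣v∣≡r⇒closed v e = ∣v∣⇒height≡0 (suc d) v
    (trans e (trans r≡d+s (trans (+-comm (suc d) s) (cong (_+ suc d) (sym (∣v∣≡r⇒∣∁v∣≡s v e))))))

  totalInterlacings≡bounces : ∀ (v : Subset (r + s)) → height (run (suc d) v) ≡ 0 →
                              totalInterlacings (blocksOf s v) ≡ bounces (run (suc d) v)
  totalInterlacings≡bounces v h≡0 = trans
    (totalInterlacings-blocksOf s v (proj₂ (closed-counts v h≡0))) (interlacingsOf≡bounces d v h≡0)

  s<r : s < r
  s<r = subst (s <_) (sym r≡d+s) (s≤s (m≤n+m s d))

  closed-isPartition : (v : Subset (r + s)) → height (run (suc d) v) ≡ 0 → IsPartition (blocksOf s v) r s
  closed-isPartition v h≡0 with p , q ← closed-counts v h≡0 =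
    blocksOf-isPartition s v (≤-<-trans z≤n s<r) p q

  partition-closed : (bs : List (Subset (r + s))) → IsPartition bs r s →
                     height (run (suc d) (bigBlock r bs)) ≡ 0
  partition-closed bs P = ∣v∣≡r⇒closed (bigBlock r bs) (proj₂ (partition-bigBlock s bs P))

  partition-bounces : (bs : List (Subset (r + s))) → IsPartition bs r s →
                      bounces (run (suc d) (bigBlock r bs)) ≡ totalInterlacings bs
  partition-bounces bs P = trans (sym (totalInterlacings≡bounces (bigBlock r bs) (partition-closed bs P)))
    (cong totalInterlacings (proj₁ (partition-bigBlock s bs P)))

  toWord : PartitionsOf r s i → BouncingWord (r + s) (suc d) i
  toWord record { partition = record { blocks = bs ; nonempty = ne ; disjoint = di ; covering = co ; ordered = or }
                ; shape = sh ; interl = il } =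
    bouncingWord (bigBlock r bs)
      (partition-closed bs (isPartition ne di co or sh))
      (trans (partition-bounces bs (isPartition ne di co or sh)) il)

  fromWord : BouncingWord (r + s) (suc d) i → PartitionsOf r s i
  fromWord (bouncingWord v c b) = record
    { partition = record
      { blocks   = blocksOf s v
      ; nonempty = IsPartition.nonempty (closed-isPartition v c)
      ; disjoint = IsPartition.disjoint (closed-isPartition v c)
      ; covering = IsPartition.covering (closed-isPartition v c)
      ; ordered  = IsPartition.ordered  (closed-isPartition v c)
      }
    ; shape     = IsPartition.shape (closed-isPartition v c)
    ; interl    = trans (totalInterlacings≡bounces v c) b
    }

  toWord∘fromWord : (w : BouncingWord (r + s) (suc d) i) → toWord (fromWord w) ≡ w
  toWord∘fromWord (bouncingWord v c b) = BouncingWord-≡ (recompute (≡-dec Bool._≟_ _ _)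
    (bigBlock-blocksOf s v s<r (proj₁ (closed-counts v c)) (proj₂ (closed-counts v c))))

  fromWord∘toWord : (P : PartitionsOf r s i) → fromWord (toWord P) ≡ P
  fromWord∘toWord
    record { partition = record { blocks = bs ; nonempty = ne ; disjoint = di ; covering = co ; ordered = or }
           ; shape = sh } =
    PartitionsOf-≡ (recompute (List.≡-dec (≡-dec Bool._≟_) _ _)
      (proj₁ (partition-bigBlock s bs (isPartition ne di co or sh))))

  partitions↔bouncingWords : PartitionsOf r s i ↔ BouncingWord (r + s) (suc d) i
  partitions↔bouncingWords = mk↔ₛ′ toWord fromWord toWord∘fromWord fromWord∘toWord

  partitions↔ballotWords : PartitionsOf r s i ↔ BallotWord (r + s) (suc d + i * 2)
  partitions↔ballotWords = bouncingWords↔ballotWords ↔-∘ partitions↔bouncingWords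

-- The range of the interlacing number and the final bijection.

ballot-bound : ∀ {h} (v : Subset n) → Ballot m h v → m ≤ h + n
ballot-bound []          []       = m≤m+n _ 0
ballot-bound {m = m} {h = h} (true  ∷ v) (up b)   = subst (m ≤_) (sym (+-suc h _)) (ballot-bound v b)
ballot-bound {h = suc h} (false ∷ v) (down b) =
  ≤-trans (ballot-bound v b) (≤-trans (+-monoʳ-≤ h (n≤1+n _)) (n≤1+n _))

-- A path from 0 cannot end higher than its length, which is `suc d + s * 2`.
bounces-bound : r ≡ suc d + s → BallotWord (r + s) (suc d + i * 2) → i ≤ s
bounces-bound {d = d} {s} {i} refl (ballotWord v b) = recompute (i ≤? s)
  (*-cancelʳ-≤ i s 2 (+-cancelˡ-≤ (suc d) _ _ (≤-trans (ballot-bound v b) (≤-reflexive size))))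
  where
  open +-*-Solver
  size : suc d + s + s ≡ suc d + s * 2
  size = solve 2 (λ d s → con 1 :+ d :+ s :+ s := con 1 :+ d :+ s :* con 2) refl d s

-- The word length `r + s` is rewritten as `(r + i) + b`; by `shape≡` the row lengths differ by the
-- end height `suc d + i * 2`.
partitions↔tableaux : r ≡ suc d + s → b + i ≡ s → PartitionsOf r s i ↔ Tableau (r + i) b
partitions↔tableaux {d = d} {b = b} {i} refl refl = ballotWords↔tableaux shape≡ ↔-∘
  subst (λ n → PartitionsOf (suc d + (b + i)) (b + i) i ↔ BallotWord n (suc d + i * 2)) size
    (partitions↔ballotWords {d = d} refl)
  where
  open +-*-Solver
  size : suc d + (b + i) + (b + i) ≡ suc d + (b + i) + i + b
  size = solve 3 (λ d b i → con 1 :+ d :+ (b :+ i) :+ (b :+ i) := con 1 :+ d :+ (b :+ i) :+ i :+ b) refl d b i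
  shape≡ : suc d + (b + i) + i ≡ suc d + i * 2 + b
  shape≡ = solve 3 (λ d b i → con 1 :+ d :+ (b :+ i) :+ i := con 1 :+ d :+ i :* con 2 :+ b) refl d b i

negative-SYT-empty : ∀ a s i → s < i → ¬ SYT a (+ s - + i)
-- Positivity exposes `i ∸ s` as a successor, and `SYT` then computes to the empty type.
negative-SYT-empty a s i s<i with i ∸ s | m<n⇒0<n∸m s<i | trans (ℤ.m-n≡m⊖n s i) (ℤ.⊖-< s<i)
... | suc k | _ | eq rewrite eq = λ ()

theorem3p24 : (r s i : ℕ) → s < r →
    PartitionsOf r s i ⤖ SYT (r + i) (+ s - + i)
theorem3p24 r s i s<r = ↔⇒⤖ bijection
  where
  -- The parameter `d` is `r ∸ suc s`, one less than the end height `r ∸ s` of the path.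
  r≡ : r ≡ suc (r ∸ suc s) + s
  r≡ = trans (sym (m∸n+n≡m s<r)) (+-suc _ s)

  bijection : PartitionsOf r s i ↔ SYT (r + i) (+ s - + i)
  bijection with i ≤? s
  ... | yes i≤s = subst (λ z → PartitionsOf r s i ↔ SYT (r + i) z)
    (sym (trans (ℤ.m-n≡m⊖n s i) (ℤ.⊖-≥ i≤s)))
    (partitions↔tableaux r≡ (m∸n+n≡m i≤s))
  -- For `i > s` both sides are empty: the ballot path would end above its length, and the second
  -- row would have negative length.
  ... | no i≰s = mk↔ₛ′ (⊥-elim ∘ noPartition) (⊥-elim ∘ noTableau)
    (λ T → ⊥-elim (noTableau T)) (λ P → ⊥-elim (noPartition P))
    where
    noPartition : ¬ PartitionsOf r s i
    noPartition P = i≰s (bounces-bound r≡ (Inverse.to (partitions↔ballotWords r≡) P))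
    noTableau : ¬ SYT (r + i) (+ s - + i)
    noTableau = negative-SYT-empty (r + i) s i (≰⇒> i≰s)
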